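{- Let $\mathcal{A}$ be a nonempty upward closed collection of Turing degrees that has a countable (finite or countably infinite) basis. Then there exist equivalence relations $R$ and $S$ on $\omega$, each with infinitely many equivalence classes, such that $\mathrm{DgSp}_{\Rightarrow}(R,S)=\mathcal{A}$.
   Context: For equivalence relations $R,S$ on $\omega$ and a Turing degree $\mathbf{d}$, write $R\leq_{\mathbf{d}} S$ if there is a $\mathbf{d}$-computable function $f:\omega\to\omega$ such that for all $x,y\in\omega$, $x R y \Leftrightarrow f(x) S f(y)$. The reducibility spectrum of $(R,S)$ is $\mathrm{DgSp}_{\Rightarrow}(R,S)=\{\mathbf{d} : R\leq_{\mathbf{d}} S\}$. A collection $\mathcal{A}$ of Turing degrees is upward closed if $\mathbf{a}\in\mathcal{A}$ and $\mathbf{a}\leq\mathbf{d}$ imply $\mathbf{d}\in\mathcal{A}$. A set $\mathcal{B}$ of Turing degrees is a basis of $\mathcal{A}$ if (1) the elements of $\mathcal{B}$ are pairwise Turing-incomparable, and (2) $\mathcal{A}=\{\mathbf{d} : (\exists \mathbf{b}\in\mathcal{B})(\mathbf{b}\leq\mathbf{d})\}$. -}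

module Defs where

open import Data.Bool.Base using (Bool; if_then_else_)
open import Data.Fin.Base using (Fin)
open import Data.Nat.Base using (ℕ; suc; _<_)
open import Data.Product.Base using (∃; _×_; _,_)
open import Data.Sum.Base using (_⊎_)
open import Data.Vec.Base using (Vec; []; _∷_; lookup)
open import Function.Base using (_∘_)
open import Function.Bundles using (_⇔_)
open import Function.Definitions using (Injective)
open import Level using (Level; 0ℓ)
open import Relation.Binary.Bundles using (Poset)
open import Relation.Binary.Construct.Interior.Symmetric using (poset)
open import Relation.Binary.Core using (Rel)
open import Relation.Binary.Definitions using (_Respects_; Reflexive; Transitive)
open import Relation.Binary.PropositionalEquality.Core using (_≡_)
open import Relation.Nullary.Negation.Core using (¬_)
open import Relation.Unary using (Pred; _∈_; _≐_)

private
  variable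
    a b ℓ : Level
    m n : ℕ

-- A subset of ω, given by its characteristic function.
Subsetω : Set
Subsetω = ℕ → Bool

χ : Subsetω → ℕ → ℕ
χ X x = if X x then 1 else 0

data Code : ℕ → Set where
  zer    : Code n
  succ   : Code 1
  proj   : Fin n → Code n
  oracle : Code 1
  comp   : Code m → Vec (Code n) m → Code n
  prec   : Code n → Code (suc (suc n)) → Code (suc n)
  mu     : Code (suc n) → Code n

infix 4 _⊢_[_]⇓_ _⊢_[_]⇓*_

-- X ⊢ c [ xs ]⇓ y : the program c with oracle X halts on input xs with
-- output y.  The recursion and search variable is the first argument, and
-- an unbounded search halts only if all earlier values are defined.
mutual
  data _⊢_[_]⇓_ (X : Subsetω) : Code n → Vec ℕ n → ℕ → Set where
    zer    : {xs : Vec ℕ n} → X ⊢ zer [ xs ]⇓ 0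
    succ   : ∀ {x} → X ⊢ succ [ x ∷ [] ]⇓ suc x
    proj   : ∀ {xs : Vec ℕ n} i → X ⊢ proj i [ xs ]⇓ lookup xs i
    oracle : ∀ {x} → X ⊢ oracle [ x ∷ [] ]⇓ χ X x
    comp   : ∀ {c : Code m} {ds : Vec (Code n) m} {xs ys z} →
             X ⊢ ds [ xs ]⇓* ys → X ⊢ c [ ys ]⇓ z →
             X ⊢ comp c ds [ xs ]⇓ z
    prec₀  : ∀ {c : Code n} {d xs y} →
             X ⊢ c [ xs ]⇓ y →
             X ⊢ prec c d [ 0 ∷ xs ]⇓ y
    precₛ  : ∀ {c : Code n} {d xs k y z} →
             X ⊢ prec c d [ k ∷ xs ]⇓ y → X ⊢ d [ k ∷ y ∷ xs ]⇓ z →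
             X ⊢ prec c d [ suc k ∷ xs ]⇓ z
    mu     : ∀ {c : Code (suc n)} {xs k} →
             (∀ j → j < k → ∃ λ y → X ⊢ c [ j ∷ xs ]⇓ suc y) →
             X ⊢ c [ k ∷ xs ]⇓ 0 →
             X ⊢ mu c [ xs ]⇓ k

  data _⊢_[_]⇓*_ (X : Subsetω) : Vec (Code n) m → Vec ℕ n → Vec ℕ m → Set where
    []  : {xs : Vec ℕ n} → X ⊢ [] [ xs ]⇓* []
    _∷_ : ∀ {c : Code n} {cs : Vec (Code n) m} {xs y ys} →
          X ⊢ c [ xs ]⇓ y → X ⊢ cs [ xs ]⇓* ys →
          X ⊢ c ∷ cs [ xs ]⇓* y ∷ ys

infix 4 _ComputableFrom_ _≤ᵀ_

_ComputableFrom_ : (ℕ → ℕ) → Subsetω → Set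
f ComputableFrom X = ∃ λ (c : Code 1) → ∀ x → X ⊢ c [ x ∷ [] ]⇓ f x

record _≤ᵀ_ (Y X : Subsetω) : Set where
  constructor reduces
  field
    computable : χ Y ComputableFrom X

mutual
  substOracle : Code 1 → Code n → Code n
  substOracle o zer         = zer
  substOracle o succ        = succ
  substOracle o (proj i)    = proj i
  substOracle o oracle      = o
  substOracle o (comp c ds) = comp (substOracle o c) (substOracle* o ds)
  substOracle o (prec c d)  = prec (substOracle o c) (substOracle o d)
  substOracle o (mu c)      = mu (substOracle o c)

  substOracle* : Code 1 → Vec (Code n) m → Vec (Code n) m
  substOracle* o []       = []
  substOracle* o (c ∷ cs) = substOracle o c ∷ substOracle* o cs

module _ {X Y : Subsetω} {o : Code 1} (o⇓ : ∀ x → X ⊢ o [ x ∷ [] ]⇓ χ Y x) where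
  mutual
    substOracle-⇓ : ∀ {c : Code n} {xs y} →
                    Y ⊢ c [ xs ]⇓ y → X ⊢ substOracle o c [ xs ]⇓ y
    substOracle-⇓ zer         = zer
    substOracle-⇓ succ        = succ
    substOracle-⇓ (proj i)    = proj i
    substOracle-⇓ oracle      = o⇓ _
    substOracle-⇓ (comp p q)  = comp (substOracle-⇓* p) (substOracle-⇓ q)
    substOracle-⇓ (prec₀ p)   = prec₀ (substOracle-⇓ p)
    substOracle-⇓ (precₛ p q) = precₛ (substOracle-⇓ p) (substOracle-⇓ q)
    substOracle-⇓ (mu p q)    =
      mu (λ j j<k → let (y , r) = p j j<k in y , substOracle-⇓ r) (substOracle-⇓ q)

    substOracle-⇓* : ∀ {cs : Vec (Code n) m} {xs ys} →
                     Y ⊢ cs [ xs ]⇓* ys → X ⊢ substOracle* o cs [ xs ]⇓* ys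
    substOracle-⇓* []       = []
    substOracle-⇓* (p ∷ ps) = substOracle-⇓ p ∷ substOracle-⇓* ps

ComputableFrom-mono : ∀ {f X Y} → Y ≤ᵀ X → f ComputableFrom Y → f ComputableFrom X
ComputableFrom-mono (reduces (o , o⇓)) (c , c⇓) = substOracle o c , substOracle-⇓ o⇓ ∘ c⇓

≤ᵀ-refl : Reflexive _≤ᵀ_
≤ᵀ-refl = reduces (oracle , λ _ → oracle)

≤ᵀ-trans : Transitive _≤ᵀ_
≤ᵀ-trans (reduces Z≤Y) Y≤X = reduces (ComputableFrom-mono Y≤X Z≤Y)

-- A degree is represented by any of its members; the equality of the poset
-- is Turing equivalence.
TuringDegrees : Poset 0ℓ 0ℓ 0ℓ
TuringDegrees = poset {A = Subsetω} {R = _≤ᵀ_} ≤ᵀ-refl ≤ᵀ-trans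

open Poset TuringDegrees public
  using () renaming (Carrier to Degree; _≈_ to _≡ᵀ_)

record Collection (ℓ : Level) : Set (Level.suc ℓ) where
  field
    members  : Pred Degree ℓ
    respects : members Respects _≡ᵀ_

open Collection public

UpwardClosed : Collection ℓ → Set ℓ
UpwardClosed 𝒜 = ∀ {a d} → a ∈ members 𝒜 → a ≤ᵀ d → d ∈ members 𝒜

Incomparable : Rel Degree 0ℓ
Incomparable c d = ¬ (c ≤ᵀ d) × ¬ (d ≤ᵀ c)

record IsBasis (ℬ : Collection b) (𝒜 : Collection a) : Set (a Level.⊔ b) where
  field
    incomparable : ∀ {c d} → c ∈ members ℬ → d ∈ members ℬ →
                   ¬ (c ≡ᵀ d) → Incomparable c d
    generates    : members 𝒜 ≐ λ d → ∃ λ c → c ∈ members ℬ × c ≤ᵀ d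

-- A bijection from I to the set of degrees ℬ, with a chosen representative of
-- each degree.
record Enumeration (I : Set) (ℬ : Collection ℓ) : Set ℓ where
  field
    degree     : I → Degree
    member     : ∀ i → degree i ∈ members ℬ
    injective  : Injective _≡_ _≡ᵀ_ degree
    surjective : ∀ {d} → d ∈ members ℬ → ∃ λ i → degree i ≡ᵀ d

Countable : Collection ℓ → Set ℓ
Countable ℬ = (∃ λ n → Enumeration (Fin n) ℬ) ⊎ Enumeration ℕ ℬ

infix 4 _≤[_]_

_≤[_]_ : Rel ℕ 0ℓ → Degree → Rel ℕ 0ℓ → Set
R ≤[ d ] S = ∃ λ (f : ℕ → ℕ) → f ComputableFrom d × (∀ x y → R x y ⇔ S (f x) (f y))

DgSp⇒ : Rel ℕ 0ℓ → Rel ℕ 0ℓ → Collection 0ℓ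
DgSp⇒ R S = record
  { members  = λ d → R ≤[ d ] S
  ; respects = λ c≡d (f , f-comp , f-red) →
      f , ComputableFrom-mono (Poset.reflexive TuringDegrees c≡d) f-comp , f-red
  }

InfinitelyManyClasses : Rel ℕ 0ℓ → Set
InfinitelyManyClasses R = ∃ λ (e : ℕ → ℕ) → Injective _≡_ R e

{-# OPTIONS --safe #-}
module Submission where

-- Let X 0, X 1, … represent the basis (with repetitions if it is finite), so that a
-- degree d lies in 𝒜 iff d computes some X i.  Call stamp i m = ⟨i, ⟨m, X i ↾ m⟩⟩
-- genuine.  R glues together, for each b, all ⟨b, v⟩ with v genuine, and nothing
-- else.  S consists of a copy of R on each column { stamp i x : x ∈ ω }, and of one
-- junk class holding all other numbers.  If X i is computable from d, then so is the
-- reduction x ↦ stamp i x.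
--
-- Conversely let f reduce R to S.  At most one R-class is sent to junk, so for some
-- b the class of ⟨b, genuine⟩ is sent into a single column i.  To find X i at n, look
-- for v ≢ w such that either f identifies ⟨b, v⟩ and ⟨b, w⟩, so that v is genuine and
-- reveals X i if it has the form stamp i m with m > n, or f sends both into column i
-- with claimed prefixes longer than n that agree at n.  The latter bit is right since
-- f cannot send both to junk.  Restricted to the genuine v of column i, f either has a
-- collision or takes infinitely many genuine values, so the search succeeds.  The
-- case distinction is left to the search and i is read off one value of f, which is
-- what makes the argument constructive.

open import Defs
open import Data.Nat.Base using (ℕ)
open import Data.Product.Base using (∃; ∃₂; _×_)
open import Level using (0ℓ)
open import Relation.Binary.Core using (Rel)
open import Relation.Binary.Structures using (IsEquivalence)
open import Relation.Unary using (Satisfiable; _≐_; _∈_)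

open import Data.Fin.Base using (Fin; toℕ; fromℕ<)
open import Data.Fin.Patterns using (0F; 1F; 2F; 3F)
open import Data.Fin.Properties using (pigeonhole; toℕ-fromℕ<; toℕ-injective; toℕ<n)
open import Data.Maybe.Base using (Maybe; just; nothing)
open import Data.Maybe.Properties using (just-injective)
open import Data.Nat.Base using (zero; suc; pred; _+_; _∸_; _⊓_; _≤_; _<_; s≤s; s≤s⁻¹)
open import Data.Nat.DivMod using (_mod_; m<n⇒m%n≡m)
open import Data.Nat.Properties
open import Data.Product.Base using (_,_; proj₁; proj₂)
open import Data.Product.Properties using (,-injectiveˡ; ,-injectiveʳ)
open import Data.Sum.Base using (_⊎_; inj₁; inj₂)
open import Data.Vec.Base using (Vec; []; _∷_; lookup)
open import Function.Base using (_∘_; _on_)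
open import Function.Bundles using (_⇔_; mk⇔; Equivalence)
open import Relation.Binary.Bundles using (Poset)
open import Relation.Binary.Construct.On using () renaming (isEquivalence to on-isEquivalence)
open import Relation.Binary.PropositionalEquality
  using (_≡_; _≢_; refl; sym; trans; cong; cong₂; subst; isEquivalence)
open import Relation.Nullary using (¬_; Dec; yes; no; contradiction)

private
  variable
    n : ℕ

-- Numerical tests, with 0 for truth.

ifz : ℕ → ℕ → ℕ → ℕ
ifz zero    x y = x
ifz (suc _) x y = y

ifz-zero : ∀ {c x y} → c ≡ 0 → ifz c x y ≡ x
ifz-zero refl = refl

ifz-nonzero : ∀ {c x y} → c ≢ 0 → ifz c x y ≡ y
ifz-nonzero {zero}  c≢0 = contradiction refl c≢0
ifz-nonzero {suc _} _   = refl

ifz-cases : ∀ c {x y z} → ifz c x y ≡ z → (c ≡ 0 × x ≡ z) ⊎ (c ≢ 0 × y ≡ z)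
ifz-cases zero    eq = inj₁ (refl , eq)
ifz-cases (suc _) eq = inj₂ ((λ ()) , eq)

dist : ℕ → ℕ → ℕ
dist m n = (m ∸ n) + (n ∸ m)

dist-refl : ∀ n → dist n n ≡ 0
dist-refl n = cong₂ _+_ (n∸n≡0 n) (n∸n≡0 n)

dist≡0⇒≡ : ∀ {m n} → dist m n ≡ 0 → m ≡ n
dist≡0⇒≡ {m} {n} eq =
  ≤-antisym (m∸n≡0⇒m≤n (m+n≡0⇒m≡0 (m ∸ n) eq)) (m∸n≡0⇒m≤n (m+n≡0⇒n≡0 (m ∸ n) eq))

-- Cantor pairing.

tri : ℕ → ℕ
tri zero    = 0
tri (suc k) = tri k + suc k

-- The greatest d with tri d ≤ z.
diag : ℕ → ℕ
diag zero    = 0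
diag (suc z) = ifz (dist (tri (suc (diag z))) (suc z)) (suc (diag z)) (diag z)

-- The counter grows only when the next triangular number is reached, and that happens on leaving
-- the last position `c = d` of a diagonal.
diag-tri : ∀ d c → c ≤ d → diag (tri d + c) ≡ d
diag-tri zero    zero    _ = refl
diag-tri (suc d) zero    _
  rewrite +-identityʳ (tri d + suc d) | +-suc (tri d) d | diag-tri d d ≤-refl
        | +-suc (tri d) d
  = ifz-zero (dist-refl (tri d + d))
diag-tri d       (suc c) c<d
  rewrite +-suc (tri d) c | diag-tri d c (<⇒≤ c<d) | +-suc (tri d) d
  = ifz-nonzero λ eq → <⇒≢ c<d (sym (+-cancelˡ-≡ (tri d) d c (dist≡0⇒≡ {tri d + d} eq)))

opaque
  ⟨_,_⟩ : ℕ → ℕ → ℕ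
  ⟨ a , b ⟩ = tri (a + b) + b

  π₂ : ℕ → ℕ
  π₂ z = z ∸ tri (diag z)

  π₁ : ℕ → ℕ
  π₁ z = diag z ∸ π₂ z

  diag-⟨,⟩ : ∀ a b → diag ⟨ a , b ⟩ ≡ a + b
  diag-⟨,⟩ a b = diag-tri (a + b) b (m≤n+m b a)

  π₂-⟨,⟩ : ∀ a b → π₂ ⟨ a , b ⟩ ≡ b
  π₂-⟨,⟩ a b rewrite diag-⟨,⟩ a b = m+n∸m≡n (tri (a + b)) b

  π₁-⟨,⟩ : ∀ a b → π₁ ⟨ a , b ⟩ ≡ a
  π₁-⟨,⟩ a b rewrite π₂-⟨,⟩ a b | diag-⟨,⟩ a b = m+n∸n≡m a b

-- Coded initial segments and least zeros.

pop : ℕ → ℕ → ℕ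
pop zero    t = t
pop (suc k) t = π₂ (pop k t)

prefix : (ℕ → ℕ) → ℕ → ℕ
prefix h zero    = 0
prefix h (suc m) = ⟨ h m , prefix h m ⟩

-- In `prefix h m` the latest value is on top, so `h n` lies under `m ∸ suc n` others.
bit : ℕ → ℕ → ℕ → ℕ
bit t m n = π₁ (pop (m ∸ suc n) t)

pop-prefix : ∀ h k m → pop k (prefix h (k + m)) ≡ prefix h m
pop-prefix h zero    m = refl
pop-prefix h (suc k) m = trans
  (cong (λ l → π₂ (pop k (prefix h l))) (sym (+-suc k m)))
  (trans (cong π₂ (pop-prefix h k (suc m))) (π₂-⟨,⟩ (h m) (prefix h m)))

bit-prefix : ∀ h {m n} → n < m → bit (prefix h m) m n ≡ h n
bit-prefix h {m} {n} n<m = trans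
  (cong (λ l → π₁ (pop (m ∸ suc n) (prefix h l))) (sym (m∸n+n≡m n<m)))
  (trans (cong π₁ (pop-prefix h (m ∸ suc n) (suc n))) (π₁-⟨,⟩ (h n) (prefix h n)))

-- The successor form of the last component is what the rule `mu` asks of earlier values.
least : (h : ℕ → ℕ) → ∀ k → h k ≡ 0 →
        ∃ λ k → h k ≡ 0 × (∀ j → j < k → ∃ λ y → h j ≡ suc y)
least h zero eq = 0 , eq , λ _ ()
least h (suc k) eq with h 0 in h0
... | zero  = 0 , h0 , λ _ ()
... | suc y with least (h ∘ suc) k eq
...   | l , hl≡0 , below = suc l , hl≡0 , λ where
    zero    _   → y , h0
    (suc j) j<l → below j (s≤s⁻¹ j<l)

-- Functions computable from an oracle.

module _ {D : Subsetω} where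

  -- The argument is a whole context, so terms built from `var` and the `app` combinators yield
  -- their codes compositionally.
  Computable : (Vec ℕ n → ℕ) → Set
  Computable F = ∃ λ c → ∀ xs → D ⊢ c [ xs ]⇓ F xs

  Computable₁ : (ℕ → ℕ) → Set
  Computable₁ g = g ComputableFrom D

  Computable₂ : (ℕ → ℕ → ℕ) → Set
  Computable₂ g = ∃ λ c → ∀ x y → D ⊢ c [ x ∷ y ∷ [] ]⇓ g x y

  Computable₃ : (ℕ → ℕ → ℕ → ℕ) → Set
  Computable₃ g = ∃ λ c → ∀ x y z → D ⊢ c [ x ∷ y ∷ z ∷ [] ]⇓ g x y z

  computable₁ : {F : Vec ℕ 1 → ℕ} → Computable F → Computable₁ (λ x → F (x ∷ []))
  computable₁ (c , c⇓) = c , λ x → c⇓ _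

  computable₂ : {F : Vec ℕ 2 → ℕ} → Computable F → Computable₂ (λ x y → F (x ∷ y ∷ []))
  computable₂ (c , c⇓) = c , λ x y → c⇓ _

  computable₃ : {F : Vec ℕ 3 → ℕ} → Computable F → Computable₃ (λ x y z → F (x ∷ y ∷ z ∷ []))
  computable₃ (c , c⇓) = c , λ x y z → c⇓ _

  var : (i : Fin n) → Computable (λ xs → lookup xs i)
  var i = proj i , λ _ → proj i

  app₁ : ∀ {g} {F : Vec ℕ n → ℕ} → Computable₁ g → Computable F →
         Computable (λ xs → g (F xs))
  app₁ (c , c⇓) (d , d⇓) = comp c (d ∷ []) , λ xs → comp (d⇓ xs ∷ []) (c⇓ _)

  app₂ : ∀ {g} {F G : Vec ℕ n → ℕ} → Computable₂ g → Computable F → Computable G →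
         Computable (λ xs → g (F xs) (G xs))
  app₂ (c , c⇓) (d , d⇓) (e , e⇓) =
    comp c (d ∷ e ∷ []) , λ xs → comp (d⇓ xs ∷ e⇓ xs ∷ []) (c⇓ _ _)

  app₃ : ∀ {g} {F G H : Vec ℕ n → ℕ} → Computable₃ g →
         Computable F → Computable G → Computable H →
         Computable (λ xs → g (F xs) (G xs) (H xs))
  app₃ (c , c⇓) (d , d⇓) (e , e⇓) (f , f⇓) =
    comp c (d ∷ e ∷ f ∷ []) , λ xs → comp (d⇓ xs ∷ e⇓ xs ∷ f⇓ xs ∷ []) (c⇓ _ _ _)

  suc-computable : Computable₁ suc
  suc-computable = succ , λ _ → succ

  const-computable : ∀ k → Computable {n} (λ _ → k)
  const-computable zero    = zer , λ _ → zer
  const-computable (suc k) = app₁ suc-computable (const-computable k)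

  -- Checking equations for a given `h` lets functions defined by pattern matching keep their
  -- definitions.
  recursive : ∀ {z : Vec ℕ n → ℕ} {s} (h : ℕ → Vec ℕ n → ℕ) →
              Computable z → Computable s →
              (∀ xs → z xs ≡ h 0 xs) → (∀ k xs → s (k ∷ h k xs ∷ xs) ≡ h (suc k) xs) →
              ∃ λ c → ∀ k xs → D ⊢ c [ k ∷ xs ]⇓ h k xs
  recursive {n} h (c , c⇓) (d , d⇓) h-zero h-suc = prec c d , go
    where
    go : ∀ k (xs : Vec ℕ n) → D ⊢ prec c d [ k ∷ xs ]⇓ h k xs
    go zero    xs = prec₀ (subst (D ⊢ c [ xs ]⇓_) (h-zero xs) (c⇓ xs))
    go (suc k) xs =
      precₛ (go k xs) (subst (D ⊢ d [ k ∷ h k xs ∷ xs ]⇓_) (h-suc k xs) (d⇓ _))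

  recursive₁ : ∀ {s} (h : ℕ → ℕ) → Computable s →
               (∀ k → s (k ∷ h k ∷ []) ≡ h (suc k)) → Computable₁ h
  recursive₁ h s-comp h-suc
    with c , c⇓ ← recursive (λ k _ → h k) (const-computable (h 0)) s-comp
                    (λ _ → refl) (λ { k [] → h-suc k })
    = c , λ k → c⇓ k []

  recursive₂ : ∀ {z s} (h : ℕ → ℕ → ℕ) → Computable z → Computable s →
               (∀ x → z (x ∷ []) ≡ h 0 x) →
               (∀ k x → s (k ∷ h k x ∷ x ∷ []) ≡ h (suc k) x) → Computable₂ h
  recursive₂ h z-comp s-comp h-zero h-suc
    with c , c⇓ ← recursive (λ k xs → h k (lookup xs 0F)) z-comp s-comp
                    (λ { (x ∷ []) → h-zero x }) (λ { k (x ∷ []) → h-suc k x })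
    = c , λ k x → c⇓ k (x ∷ [])

  +-computable : Computable₂ _+_
  +-computable = recursive₂ _+_ (var 0F) (app₁ suc-computable (var 1F))
                   (λ _ → refl) (λ _ _ → refl)

  pred-computable : Computable₁ pred
  pred-computable = recursive₁ pred (var 0F) (λ _ → refl)

  ∸-computable : Computable₂ _∸_
  ∸-computable = computable₂ (app₂ flipped (var 1F) (var 0F))
    where
    -- Primitive recursion runs on the first argument, while the recursion used for `∸` is on the
    -- subtrahend.
    flipped : Computable₂ (λ n m → m ∸ n)
    flipped = recursive₂ _ (var 0F) (app₁ pred-computable (var 1F))
                (λ _ → refl) (λ n m → pred[m∸n]≡m∸[1+n] m n)

  ifz-computable : Computable₃ ifz
  ifz-computable
    with c , c⇓ ← recursive (λ k xs → ifz k (lookup xs 0F) (lookup xs 1F)) (var 0F)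
                    (var 3F) (λ _ → refl) (λ { k (x ∷ y ∷ []) → refl })
    = c , λ k x y → c⇓ k (x ∷ y ∷ [])

  dist-computable : Computable₂ dist
  dist-computable = computable₂
    (app₂ +-computable (app₂ ∸-computable (var 0F) (var 1F)) (app₂ ∸-computable (var 1F) (var 0F)))

  tri-computable : Computable₁ tri
  tri-computable = recursive₁ tri
    (app₂ +-computable (var 1F) (app₁ suc-computable (var 0F))) (λ _ → refl)

  diag-computable : Computable₁ diag
  diag-computable = recursive₁ diag
    (app₃ ifz-computable
      (app₂ dist-computable (app₁ tri-computable (app₁ suc-computable (var 1F)))
                            (app₁ suc-computable (var 0F)))
      (app₁ suc-computable (var 1F)) (var 1F))
    (λ _ → refl)

  opaque
    unfolding ⟨_,_⟩

    ⟨,⟩-computable : Computable₂ ⟨_,_⟩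
    ⟨,⟩-computable = computable₂
      (app₂ +-computable (app₁ tri-computable (app₂ +-computable (var 0F) (var 1F))) (var 1F))

    π₂-computable : Computable₁ π₂
    π₂-computable = computable₁
      (app₂ ∸-computable (var 0F) (app₁ tri-computable (app₁ diag-computable (var 0F))))

    π₁-computable : Computable₁ π₁
    π₁-computable = computable₁
      (app₂ ∸-computable (app₁ diag-computable (var 0F)) (app₁ π₂-computable (var 0F)))

  pop-computable : Computable₂ pop
  pop-computable = recursive₂ pop (var 0F) (app₁ π₂-computable (var 1F))
                     (λ _ → refl) (λ _ _ → refl)

  bit-computable : Computable₃ bit
  bit-computable = computable₃ (app₁ π₁-computable (app₂ pop-computable
    (app₂ ∸-computable (var 1F) (app₁ suc-computable (var 2F))) (var 0F)))

  prefix-computable : ∀ {h} → Computable₁ h → Computable₁ (prefix h)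
  prefix-computable {h} h-comp = recursive₁ (prefix h)
    (app₂ ⟨,⟩-computable (app₁ h-comp (var 0F)) (var 1F)) (λ _ → refl)

  minimization : ∀ {F : ℕ → ℕ → ℕ} → Computable₂ F → (∀ x → ∃ λ k → F k x ≡ 0) →
                 ∃ λ m → Computable₁ m × (∀ x → F (m x) x ≡ 0)
  minimization {F} (c , c⇓) zeros =
    (λ x → proj₁ (min x)) ,
    (mu c , λ x → mu
      (λ j j<m → let y , eq = proj₂ (proj₂ (min x)) j j<m in
                 y , subst (D ⊢ c [ j ∷ x ∷ [] ]⇓_) eq (c⇓ j x))
      (subst (D ⊢ c [ proj₁ (min x) ∷ x ∷ [] ]⇓_) (proj₁ (proj₂ (min x))) (c⇓ _ x))) ,
    (λ x → proj₁ (proj₂ (min x)))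
    where
    min : ∀ x → ∃ λ k → F k x ≡ 0 × (∀ j → j < k → ∃ λ y → F j x ≡ suc y)
    min x = let k , eq = zeros x in least (λ k → F k x) k eq

  -- E w x = suc y says that w certifies the value y at x.
  certified-computable : ∀ {E : ℕ → ℕ → ℕ} {g} → Computable₂ E →
    (∀ w x y → E w x ≡ suc y → y ≡ g x) → (∀ x → ∃ λ w → E w x ≡ suc (g x)) →
    Computable₁ g
  certified-computable {E} {g} E-comp sound complete
    with m , m-comp , m-zero ← minimization
           -- `mu` stops at 0, so a successful certificate has to be sent to 0 and a failed one to
           -- 1.
           (computable₂ (app₃ ifz-computable (app₂ E-comp (var 0F) (var 1F))
             (const-computable 1) (const-computable 0)))
           (λ x → let w , eq = complete x in w , cong (λ e → ifz e 1 0) eq)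
    with c , c⇓ ← computable₁ (app₁ pred-computable
                    (app₂ E-comp (app₁ m-comp (var 0F)) (var 0F)))
    = c , λ x → subst (D ⊢ c [ x ∷ [] ]⇓_) (value x) (c⇓ x)
    where
    value : ∀ x → pred (E (m x) x) ≡ g x
    value x with E (m x) x in eq | m-zero x
    ... | suc y | _ = sound (m x) x y eq

-- For the pigeonhole argument on capped lengths: a common value below the cap is exact, and
-- reaching the cap bounds both from below.
⊓-collision : ∀ {k l} m → k ⊓ m ≡ l ⊓ m → k ≡ l ⊎ (m ≤ k × m ≤ l)
⊓-collision {k} {l} m eq with ≤-total k m | ≤-total l m
... | inj₁ k≤m | inj₁ l≤m = inj₁ (trans (sym (m≤n⇒m⊓n≡m k≤m)) (trans eq (m≤n⇒m⊓n≡m l≤m)))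
... | inj₂ m≤k | _        = inj₂ (m≤k , m⊓n≡n⇒n≤m (trans (sym eq) (m≥n⇒m⊓n≡n m≤k)))
... | _        | inj₂ m≤l = inj₂ (m⊓n≡n⇒n≤m (trans eq (m≥n⇒m⊓n≡n m≤l)) , m≤l)

-- The relations `R` and `S` of a sequence of sets.

module _ (X : ℕ → Subsetω) where

  -- The prefix records X i up to m, so that a bound on the prefixes occurring in
  -- one column bounds the number of genuine elements there.
  stamp : ℕ → ℕ → ℕ
  stamp i m = ⟨ i , ⟨ m , prefix (χ (X i)) m ⟩ ⟩

  column len content : ℕ → ℕ
  column    = π₁
  len     v = π₁ (π₂ v)
  content v = π₂ (π₂ v)

  column-stamp : ∀ i m → column (stamp i m) ≡ i
  column-stamp i m = π₁-⟨,⟩ i _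

  len-stamp : ∀ i m → len (stamp i m) ≡ m
  len-stamp i m = trans (cong π₁ (π₂-⟨,⟩ i _)) (π₁-⟨,⟩ m _)

  content-stamp : ∀ i m → content (stamp i m) ≡ prefix (χ (X i)) m
  content-stamp i m = trans (cong π₂ (π₂-⟨,⟩ i _)) (π₂-⟨,⟩ m _)

  -- Recovering `i` and `m` from `v` turns this into an equation between numbers, decidable for
  -- every `X`, though not necessarily by a program.
  Genuine : ℕ → Set
  Genuine v = v ≡ stamp (column v) (len v)

  genuine? : ∀ v → Dec (Genuine v)
  genuine? v = v ≟ stamp (column v) (len v)

  stamp-genuine : ∀ i m → Genuine (stamp i m)
  stamp-genuine i m = sym (cong₂ stamp (column-stamp i m) (len-stamp i m))

  forget : ℕ → Maybe ℕ
  forget v with genuine? v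
  ... | yes _ = nothing
  ... | no  _ = just v

  forget-genuine : ∀ {v} → Genuine v → forget v ≡ nothing
  forget-genuine {v} gv with genuine? v
  ... | yes _  = refl
  ... | no ¬gv = contradiction gv ¬gv

  -- `just v` remembers `v`, so distinct numbers can meet only at `nothing`.
  forget-injective : ∀ {v w} → v ≢ w → forget v ≡ forget w → Genuine v
  forget-injective {v} {w} v≢w eq with genuine? v | genuine? w
  ... | yes gv | _    = gv
  ... | no _   | no _ = contradiction (just-injective eq) v≢w

  class : ℕ → ℕ × Maybe ℕ
  class x = π₁ x , forget (π₂ x)

  class-⟨,⟩ : ∀ b v → class ⟨ b , v ⟩ ≡ (b , forget v)
  class-⟨,⟩ b v = cong₂ _,_ (π₁-⟨,⟩ b v) (cong forget (π₂-⟨,⟩ b v))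

  stampedClass : ℕ → Maybe (ℕ × ℕ × Maybe ℕ)
  stampedClass u with genuine? u
  ... | yes _ = just (column u , class (len u))
  ... | no  _ = nothing

  stampedClass-stamp : ∀ i x → stampedClass (stamp i x) ≡ just (i , class x)
  stampedClass-stamp i x with genuine? (stamp i x)
  ... | yes _  = cong just (cong₂ _,_ (column-stamp i x) (cong class (len-stamp i x)))
  ... | no ¬gu = contradiction (stamp-genuine i x) ¬gu

  stampedClass-just : ∀ {u i ρ} → stampedClass u ≡ just (i , ρ) → u ≡ stamp i (len u)
  stampedClass-just {u} eq with genuine? u
  stampedClass-just refl | yes gu = gu

  stampedClass-nothing : ∀ {u} → ¬ Genuine u → stampedClass u ≡ nothing
  stampedClass-nothing {u} ¬gu with genuine? u
  ... | yes gu = contradiction gu ¬gu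
  ... | no _   = refl

  R S : Rel ℕ 0ℓ
  R = _≡_ on class
  S = _≡_ on stampedClass

  -- A chosen point of the glued class in block `b`; `stamp 0 0` is genuine for every `X`.
  anchor : ℕ → ℕ
  anchor b = ⟨ b , stamp 0 0 ⟩

  class-anchor : ∀ b → class (anchor b) ≡ (b , nothing)
  class-anchor b = trans (class-⟨,⟩ b _) (cong (b ,_) (forget-genuine (stamp-genuine 0 0)))

  anchor-injective : ∀ b c → R (anchor b) (anchor c) → b ≡ c
  anchor-injective b c eq =
    ,-injectiveˡ (trans (sym (class-anchor b)) (trans eq (class-anchor c)))

  R-infinite : InfinitelyManyClasses R
  R-infinite = anchor , λ {b} {c} → anchor-injective b c

  stamp-reduces : ∀ i x y → R x y ⇔ S (stamp i x) (stamp i y)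
  stamp-reduces i x y = mk⇔
    (λ eq → trans (stampedClass-stamp i x)
      (trans (cong (λ ρ → just (i , ρ)) eq) (sym (stampedClass-stamp i y))))
    (λ eq → ,-injectiveʳ (just-injective
      (trans (sym (stampedClass-stamp i x)) (trans eq (stampedClass-stamp i y)))))

  S-infinite : InfinitelyManyClasses S
  S-infinite = stamp 0 ∘ anchor , λ {b} {c} eq →
    anchor-injective b c (Equivalence.from (stamp-reduces 0 (anchor b) (anchor c)) eq)

  reduction : ∀ {i D} → X i ≤ᵀ D → R ≤[ D ] S
  reduction {i} (reduces χ-comp) = stamp i , computable , stamp-reduces i
    where
    computable : Computable₁ (stamp i)
    computable = computable₁ (app₂ ⟨,⟩-computable (const-computable i)
      (app₂ ⟨,⟩-computable (var 0F) (app₁ (prefix-computable χ-comp) (var 0F))))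

  -- Reading bits off stamps.

  -- 0 means that u records no bit at n for column i.
  readBit : ℕ → ℕ → ℕ → ℕ
  readBit i u n =
    -- The sum is 0 iff `u` lies in column `i` and its length exceeds `n`.
    ifz (dist (column u) i + (suc n ∸ len u)) (suc (bit (content u) (len u) n)) 0

  readBit-sound : ∀ {i u n y} → Genuine u → readBit i u n ≡ suc y → y ≡ χ (X i) n
  readBit-sound {i} {u} {n} {y} gu eq with ifz-cases (dist (column u) i + (suc n ∸ len u)) eq
  ... | inj₁ (c≡0 , refl) = trans
    (cong (λ t → bit t (len u) n) (trans (cong content gu) (content-stamp (column u) (len u))))
    (trans (bit-prefix (χ (X (column u))) {len u} (m∸n≡0⇒m≤n (m+n≡0⇒n≡0 (dist (column u) i) c≡0)))
           (cong (λ j → χ (X j) n) (dist≡0⇒≡ (m+n≡0⇒m≡0 (dist (column u) i) c≡0))))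

  readBit-stamp : ∀ {i m n} → n < m → readBit i (stamp i m) n ≡ suc (χ (X i) n)
  readBit-stamp {i} {m} {n} n<m = trans
    (ifz-zero (cong₂ _+_
      (trans (cong (λ j → dist j i) (column-stamp i m)) (dist-refl i))
      (trans (cong (suc n ∸_) (len-stamp i m)) (m≤n⇒m∸n≡0 n<m))))
    (cong suc (trans
      (cong₂ (λ t l → bit t l n) (content-stamp i m) (len-stamp i m))
      (bit-prefix (χ (X i)) n<m)))

  readBit-computable : ∀ {D} i → Computable₂ {D} (readBit i)
  readBit-computable {D} i = computable₂
    (app₃ ifz-computable
      (app₂ +-computable (app₂ dist-computable (app₁ π₁-computable (var 0F)) (const-computable i))
        (app₂ ∸-computable (app₁ suc-computable (var 1F)) len₀))
      (app₁ suc-computable (app₃ bit-computable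
        (app₁ π₂-computable (app₁ π₂-computable (var 0F))) len₀ (var 1F)))
      (const-computable 0))
    where
    len₀ : Computable {D} {2} (λ xs → len (lookup xs 0F))
    len₀ = app₁ π₁-computable (app₁ π₂-computable (var 0F))

  -- Computing a column from a reduction.

  module _ {D f} (f-comp : f ComputableFrom D) (f-reduces : ∀ x y → R x y ⇔ S (f x) (f y)) where

    -- The anchors of blocks 0 and 1 are not `R`-equivalent, so `f` cannot send both to junk.
    non-junk : ∃₂ λ b i → ∃ λ ρ → stampedClass (f (anchor b)) ≡ just (i , ρ)
    non-junk with stampedClass (f (anchor 0)) in eq₀ | stampedClass (f (anchor 1)) in eq₁
    ... | just (i , ρ) | _            = 0 , i , ρ , eq₀
    ... | nothing      | just (i , ρ) = 1 , i , ρ , eq₁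
    ... | nothing      | nothing      = contradiction
      (anchor-injective 0 1 (Equivalence.from (f-reduces (anchor 0) (anchor 1)) (trans eq₀ (sym eq₁))))
      λ ()

    module _ {b i ρ} (f-anchor : stampedClass (f (anchor b)) ≡ just (i , ρ)) where

      g : ℕ → ℕ
      g v = f ⟨ b , v ⟩

      -- For genuine `v`, `⟨ b , v ⟩` is `R`-equivalent to `anchor b`, whose image lies in column
      -- `i`.
      g-genuine : ∀ {v} → Genuine v → g v ≡ stamp i (len (g v))
      g-genuine {v} gv = stampedClass-just (trans
        (Equivalence.to (f-reduces ⟨ b , v ⟩ (anchor b))
          (trans (class-⟨,⟩ b v) (trans (cong (b ,_) (forget-genuine gv)) (sym (class-anchor b)))))
        f-anchor)

      -- Stated for `S`-equivalence so as to cover two junk images as well as two equal ones.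
      g-collision : ∀ {v w} → v ≢ w → S (g v) (g w) → Genuine v
      g-collision {v} {w} v≢w eq = forget-injective v≢w (,-injectiveʳ (trans (sym (class-⟨,⟩ b v))
        (trans (Equivalence.from (f-reduces ⟨ b , v ⟩ ⟨ b , w ⟩) eq) (class-⟨,⟩ b w))))

      -- If g v and g w yield the same bit then that bit is right: were both junk, they
      -- would be S-equivalent, whence v is genuine and g v is not junk after all.
      certificate : ℕ → ℕ → ℕ → ℕ
      certificate v w n =
        -- A number collides with itself trivially, which certifies nothing.
        ifz (dist v w) 0
          (ifz (dist (g v) (g w)) (readBit i v n)
            (ifz (dist (readBit i (g v) n) (readBit i (g w) n)) (readBit i (g v) n) 0))

      certificate-sound : ∀ v w n y → certificate v w n ≡ suc y → y ≡ χ (X i) n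
      certificate-sound v w n y eq with ifz-cases (dist v w) eq
      ... | inj₂ (d≢0 , eq₁) with ifz-cases (dist (g v) (g w)) eq₁
      ...   | inj₁ (d≡0 , eq₂) =
        readBit-sound (g-collision v≢w (cong stampedClass (dist≡0⇒≡ d≡0))) eq₂
        where
        v≢w : v ≢ w
        v≢w refl = d≢0 (dist-refl v)
      ...   | inj₂ (_ , eq₂) with ifz-cases (dist (readBit i (g v) n) (readBit i (g w) n)) eq₂
      ...     | inj₁ (agree , eq₃) with genuine? (g v) | genuine? (g w)
      ...       | yes ggv | _       = readBit-sound ggv eq₃
      -- Only the second image is genuine, but the two bits agree.
      ...       | no _    | yes ggw = readBit-sound ggw (trans (sym (dist≡0⇒≡ agree)) eq₃)
      ...       | no ¬ggv | no ¬ggw = contradiction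
        (subst Genuine (sym (g-genuine gv)) (stamp-genuine i _)) ¬ggv
        where
        v≢w : v ≢ w
        v≢w refl = d≢0 (dist-refl v)
        gv : Genuine v
        gv = g-collision v≢w (trans (stampedClass-nothing ¬ggv) (sym (stampedClass-nothing ¬ggw)))

      -- Among n + 3 genuine v's, two have images of equal length, hence equal images,
      -- or two have images longer than n.
      certificate-complete : ∀ n → ∃₂ λ v w → certificate v w n ≡ suc (χ (X i) n)
      certificate-complete n =
        -- Lengths capped at `suc n` take at most `2 + n` values, one fewer than there are elements
        -- `v p`.
        let p , q , p<q , eq = pigeonhole (n<1+n (2 + n)) capped in
        v p , v q , trans (ifz-nonzero (v-distinct p<q ∘ dist≡0⇒≡)) (reads p q (collision p q eq))
        where
        v : Fin (3 + n) → ℕ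
        -- Length at least `suc n`: if the images collide, `v p` itself records the bit at `n`.
        v p = stamp i (suc n + toℕ p)

        v-distinct : ∀ {p q} → toℕ p < toℕ q → v p ≢ v q
        v-distinct {p} {q} p<q eq = <⇒≢ p<q (+-cancelˡ-≡ (suc n) (toℕ p) (toℕ q)
          (trans (sym (len-stamp i _)) (trans (cong len eq) (len-stamp i _))))

        l : Fin (3 + n) → ℕ
        l p = len (g (v p))

        capped : Fin (3 + n) → Fin (2 + n)
        capped p = fromℕ< (s≤s (m⊓n≤n (l p) (suc n)))

        g-v : ∀ p → g (v p) ≡ stamp i (l p)
        g-v p = g-genuine (stamp-genuine i _)

        collision : ∀ p q → capped p ≡ capped q → l p ≡ l q ⊎ (n < l p × n < l q)
        collision p q eq = ⊓-collision (suc n)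
          (trans (sym (toℕ-fromℕ< _)) (trans (cong toℕ eq) (toℕ-fromℕ< _)))

        read-g : ∀ p → n < l p → readBit i (g (v p)) n ≡ suc (χ (X i) n)
        read-g p n<l = trans (cong (λ u → readBit i u n) (g-v p)) (readBit-stamp n<l)

        reads : ∀ p q → l p ≡ l q ⊎ (n < l p × n < l q) →
          ifz (dist (g (v p)) (g (v q))) (readBit i (v p) n)
            (ifz (dist (readBit i (g (v p)) n) (readBit i (g (v q)) n)) (readBit i (g (v p)) n) 0)
          ≡ suc (χ (X i) n)
        -- Equality of the images is tested first, as in `certificate`, because long images may
        -- coincide too.
        reads p q long with g (v p) ≟ g (v q)
        ... | yes same = trans
          (ifz-zero (trans (cong (λ u → dist u (g (v q))) same) (dist-refl (g (v q)))))
          (readBit-stamp (m≤m+n (suc n) (toℕ p)))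
        reads p q (inj₁ lp≡lq) | no differ =
          contradiction (trans (g-v p) (trans (cong (stamp i) lp≡lq) (sym (g-v q)))) differ
        reads p q (inj₂ (n<lp , n<lq)) | no differ = trans
          (ifz-nonzero (differ ∘ dist≡0⇒≡))
          (trans
            (ifz-zero (trans
              (cong₂ dist (read-g p n<lp) (read-g q n<lq)) (dist-refl (suc (χ (X i) n)))))
            (read-g p n<lp))

      -- One number codes the pair being searched for; `b` and `i` are constants of the program.
      column-computable : X i ≤ᵀ D
      column-computable = reduces (certified-computable
        (computable₂ (app₃ certificate-computable
          (app₁ π₁-computable (var 0F)) (app₁ π₂-computable (var 0F)) (var 1F)))
        (λ w → certificate-sound (π₁ w) (π₂ w))
        (λ n → let v , w , eq = certificate-complete n in ⟨ v , w ⟩ ,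
          trans (cong₂ (λ v w → certificate v w n) (π₁-⟨,⟩ v w) (π₂-⟨,⟩ v w)) eq))
        where
        g-computable : Computable₁ g
        g-computable = computable₁
          (app₁ f-comp (app₂ ⟨,⟩-computable (const-computable b) (var 0F)))

        certificate-computable : Computable₃ certificate
        certificate-computable = computable₃
          (app₃ ifz-computable (app₂ dist-computable (var 0F) (var 1F)) (const-computable 0)
            (app₃ ifz-computable
              (app₂ dist-computable (app₁ g-computable (var 0F)) (app₁ g-computable (var 1F)))
              (app₂ (readBit-computable i) (var 0F) (var 2F))
              (app₃ ifz-computable
                (app₂ dist-computable readv
                  (app₂ (readBit-computable i) (app₁ g-computable (var 1F)) (var 2F)))
                readv (const-computable 0))))
          where
          readv : Computable {D} {3} (λ xs → readBit i (g (lookup xs 0F)) (lookup xs 2F))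
          readv = app₂ (readBit-computable i) (app₁ g-computable (var 0F)) (var 2F)

  spectrum : ∀ {D} → R ≤[ D ] S → ∃ λ i → X i ≤ᵀ D
  spectrum (f , f-comp , f-reduces) with b , i , ρ , f-anchor ← non-junk f-comp f-reduces =
    i , column-computable f-comp f-reduces f-anchor

-- From a countable basis to a sequence of degrees.

module _ {a b} {𝒜 : Collection a} {ℬ : Collection b} where

  GeneratedBy : {I : Set} → (I → Degree) → Set a
  GeneratedBy X = members 𝒜 ≐ λ d → ∃ λ i → X i ≤ᵀ d

  generated : ∀ {I} → IsBasis ℬ 𝒜 → (e : Enumeration I ℬ) → GeneratedBy (Enumeration.degree e)
  generated basis e = below , above
    where
    open IsBasis basis
    open Enumeration e
    below : ∀ {d} → d ∈ members 𝒜 → ∃ λ i → degree i ≤ᵀ d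
    below d∈𝒜 with c , c∈ℬ , c≤d ← proj₁ generates d∈𝒜 with i , i≡c ← surjective c∈ℬ =
      i , ≤ᵀ-trans (Poset.reflexive TuringDegrees i≡c) c≤d
    above : ∀ {d} → (∃ λ i → degree i ≤ᵀ d) → d ∈ members 𝒜
    above (i , i≤d) = proj₂ generates (degree i , member i , i≤d)

  -- The finite family is repeated periodically; the index `toℕ i` is its own residue.
  generated-mod : ∀ {n} {X : Fin (suc n) → Degree} → GeneratedBy X → GeneratedBy (X ∘ (_mod suc n))
  generated-mod {n} {X} (below , above) =
    (λ d∈𝒜 → let i , i≤d = below d∈𝒜 in
      toℕ i , subst (λ j → X j ≤ᵀ _) (sym (toℕ-mod i)) i≤d) ,
    (λ (k , k≤d) → above (k mod suc n , k≤d))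
    where
    toℕ-mod : (i : Fin (suc n)) → toℕ i mod suc n ≡ i
    toℕ-mod i = toℕ-injective (trans (toℕ-fromℕ< _) (m<n⇒m%n≡m (toℕ<n i)))

  generated-by-sequence : Satisfiable (members 𝒜) → IsBasis ℬ 𝒜 → Countable ℬ →
                          ∃ λ (X : ℕ → Degree) → GeneratedBy X
  -- An empty basis generates only the empty collection.
  generated-by-sequence (_ , d∈𝒜) basis (inj₁ (zero , e))
    with () ← proj₁ (proj₁ (generated basis e) d∈𝒜)
  generated-by-sequence _ basis (inj₁ (suc n , e)) = _ , generated-mod (generated basis e)
  generated-by-sequence _ basis (inj₂ e)           = _ , generated basis e

theorem2p4 : ∀ {a b} (𝒜 : Collection a) →
    Satisfiable (members 𝒜) →
    UpwardClosed 𝒜 →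
    (∃ λ (ℬ : Collection b) → IsBasis ℬ 𝒜 × Countable ℬ) →
    ∃₂ λ (R S : Rel ℕ 0ℓ) →
    IsEquivalence R × IsEquivalence S ×
    InfinitelyManyClasses R × InfinitelyManyClasses S ×
    members (DgSp⇒ R S) ≐ members 𝒜
theorem2p4 𝒜 nonempty _ (ℬ , basis , countable)
  with X , below , above ← generated-by-sequence nonempty basis countable =
  R X , S X ,
  on-isEquivalence (class X) isEquivalence , on-isEquivalence (stampedClass X) isEquivalence ,
  R-infinite X , S-infinite X ,
  above ∘ spectrum X ,
  λ d∈𝒜 → reduction X (proj₂ (below d∈𝒜))
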